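{- Let $\mathcal{A}=\langle S,s^0,L,\Delta\rangle$ be a probabilistic automaton, let $s,s'\in S$, and let $c\subseteq\{(s,a,\mu)\in\Delta\mid a=\tau,\ \mu\text{ is deterministic}\}$ be a weakly probabilistically confluent set of its $\tau$-transitions. If $s\leftrightarrow_c^* s'$, then $s$ and $s'$ are branching probabilistically bisimilar.
   Context: Distributions. $\mathrm{Distr}(S)$ is the set of probability distributions $\mu:S\to[0,1]$, $\sum_{s\in S}\mu(s)=1$, on a countable set $S$. $\mathbb{1}_t$ is the deterministic distribution with $\mathbb{1}_t(t)=1$. For an equivalence relation $R$ on $S$, $\mu\equiv_R\mu'$ means $\mu(C)=\mu'(C)$ for all $C\in S/R$, where $\mu(C)=\sum_{s\in C}\mu(s)$. Probabilistic automata. A probabilistic automaton (PA) is a tuple $\langle S,s^0,L,\Delta\rangle$ with $S$ a countable set of states, $s^0\in S$ initial, $L$ a countable set of actions containing the unobservable action $\tau$, and $\Delta\subseteq S\times L\times\mathrm{Distr}(S)$ a countable transition relation. Write $s\xrightarrow{a}\mu$ for $(s,a,\mu)\in\Delta$, and $s\xrightarrow{a}t$ for $s\xrightarrow{a}\mathbb{1}_t$. Paths and schedulers. A finite path is a sequence $\pi=s_0\,(a_1,\mu_1)\,s_1\,(a_2,\mu_2)\cdots(a_n,\mu_n)\,s_n$ ($n\ge 0$) with $s_{i}\xrightarrow{a_{i+1}}\mu_{i+1}$ and $\mu_{i+1}(s_{i+1})>0$; $\mathrm{last}(\pi)=s_n$. A scheduler $\mathcal{S}$ assigns to every finite path $\pi$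 a probability distribution over $\{\bot\}\cup\Delta$, giving positive probability only to $\bot$ and to transitions $(s,a,\mu)$ with $s=\mathrm{last}(\pi)$ ($\bot$ means stopping). The probability of $\pi$ from $s$ is defined by $P_s^{\mathcal{S}}(s)=1$, $P_s^{\mathcal{S}}(\pi\,(a,\mu)\,t)=P_s^{\mathcal{S}}(\pi)\cdot\mathcal{S}(\pi)(\mathrm{last}(\pi),a,\mu)\cdot\mu(t)$. A maximal path of $\mathcal{S}$ from $s$ is a finite path from $s$ all of whose transitions are scheduled with positive probability after the corresponding prefix and with $\mathcal{S}(\pi)(\bot)>0$. The final state (sub)distribution is $F^{\mathcal{S}}(s)(s')=\sum_{\pi}P_s^{\mathcal{S}}(\pi)\cdot\mathcal{S}(\pi)(\bot)$, over maximal paths $\pi$ of $\mathcal{S}$ from $s$ with $\mathrm{last}(\pi)=s'$. Branching steps. For an equivalence relation $R$ on $S$, $s\Rightarrow^a_R\mu$ if either (1) $a=\tau$ and $\mu=\mathbb{1}_s$, or (2) there is a scheduler $\mathcal{S}$ with $F^{\mathcal{S}}(s)=\mu$ such that every maximal path $s\,(a_1,\mu_1)\,s_1\cdots(a_n,\mu_n)\,s_n$ of $\mathcal{S}$ from $s$ satisfies $a_n=a$ (in particular $n\ge1$) and $a_i=\tau$, $(s,s_i)\in R$ for all $1\le i<n$. Bisimulation. An equivalence relation $R\subseteq S\times S$ is a branching probabilistic bisimulation if for all $(s,t)\in R$: $s\xrightarrow{a}\mu$ implies $\exists\mu'\in\mathrm{Distr}(S)$ with $t\Rightarrow^a_R\mu'$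 and $\mu\equiv_R\mu'$. States $p,q$ are branching probabilistically bisimilar if $(p,q)\in R$ for some branching probabilistic bisimulation $R$. Confluence. Let $c$ be a set of $\tau$-transitions with deterministic distributions. Write $s\to_c t$ if $(s,\tau,\mathbb{1}_t)\in c$; $s\twoheadrightarrow_c t$ if there is a finite (possibly empty) path of $\to_c$-steps from $s$ to $t$; $s\leftrightarrow_c^* t$ if $s$ and $t$ are connected by finitely many (possibly zero) $\to_c$-steps, each of which may be traversed in either direction. Let $R_c=\{(s,s')\mid\exists u:\ s\twoheadrightarrow_c u\text{ and }s'\twoheadrightarrow_c u\}$. The set $c$ is weakly probabilistically confluent if $R_c$ is an equivalence relation and, for every path $s\twoheadrightarrow_c t$ and all $a\in L$, $\mu\in\mathrm{Distr}(S)$: $s\xrightarrow{a}\mu$ implies that there is $t'\in S$ with $t\twoheadrightarrow_c t'$ and [($\exists\nu\in\mathrm{Distr}(S)$: $t'\xrightarrow{a}\nu$ and $\mu\equiv_{R_c}\nu$) or ($a=\tau$ and $\mu\equiv_{R_c}\mathbb{1}_{t'}$)]. -}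

module Defs where

open import Data.Empty using (⊥)
open import Data.List.Base using (List; []; _∷_)
open import Data.List.Relation.Unary.All using (All; []; _∷_)
open import Data.List.Relation.Unary.AllPairs using ([]; _∷_)
open import Data.List.Relation.Unary.Unique.Propositional using (Unique)
open import Data.Maybe.Base using (Maybe; just; nothing)
open import Data.Nat.Base using (ℕ)
open import Data.Product.Base using (Σ; ∃; ∃-syntax; _×_; _,_)
open import Data.Rational.Base as ℚ using (ℚ; 0ℚ; 1ℚ)
import Data.Rational.Properties as ℚ
open import Data.Sum.Base using (_⊎_; inj₁; inj₂)
open import Data.Unit.Base using (⊤; tt)
open import Function.Bundles using (_↣_)
open import Level using (0ℓ)
open import Relation.Binary.Construct.Closure.Equivalence using (EqClosure)
open import Relation.Binary.Construct.Closure.ReflexiveTransitive using (Star)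
open import Relation.Binary.Core using (Rel)
open import Relation.Binary.PropositionalEquality
  using (_≡_; refl; sym; trans; cong; subst)
open import Relation.Binary.Structures using (IsEquivalence)
open import Relation.Nullary.Negation using (contradiction)
open import Relation.Unary using (Pred; U; _≐_)

------------------------------------------------------------------------
-- Non-negative extended reals

-- A number x is given by its lower cut { q ∣ q < x }.  Lower cuts are closed
-- under arbitrary suprema, so every sum of non-negative terms exists.

record [0,∞] : Set₁ where
  field
    cut         : Pred ℚ 0ℓ
    down-closed : ∀ {p q} → p ℚ.≤ q → cut q → cut p
    open-above  : ∀ {p} → cut p → ∃[ q ] p ℚ.< q × cut q
    nonnegative : ∀ {q} → q ℚ.< 0ℚ → cut q

open [0,∞] public

infix 4 _≈_
infixl 6 _⊕_
infixl 7 _⊗_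

_≈_ : Rel [0,∞] 0ℓ
x ≈ y = cut x ≐ cut y

Positive : Pred [0,∞] 0ℓ
Positive x = cut x 0ℚ

-- The indicator of a proposition: 1 if P holds and 0 otherwise.
[_] : Set → [0,∞]
[ P ] .cut q = q ℚ.< 0ℚ ⊎ P × q ℚ.< 1ℚ
[ P ] .down-closed p≤q (inj₁ q<0)       = inj₁ (ℚ.≤-<-trans p≤q q<0)
[ P ] .down-closed p≤q (inj₂ (x , q<1)) = inj₂ (x , ℚ.≤-<-trans p≤q q<1)
[ P ] .open-above (inj₁ p<0) =
  let r , p<r , r<0 = ℚ.<-dense p<0 in r , p<r , inj₁ r<0
[ P ] .open-above (inj₂ (x , p<1)) =
  let r , p<r , r<1 = ℚ.<-dense p<1 in r , p<r , inj₂ (x , r<1)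
[ P ] .nonnegative = inj₁

𝟘 𝟙 : [0,∞]
𝟘 = [ ⊥ ]
𝟙 = [ ⊤ ]

private
  cancel : ∀ a q → a ℚ.+ (q ℚ.- a) ≡ q
  cancel a q = trans (ℚ.+-comm a (q ℚ.- a))
    (trans (ℚ.+-assoc q (ℚ.- a) a)
      (trans (cong (q ℚ.+_) (ℚ.+-inverseˡ a)) (ℚ.+-identityʳ q)))

  split-negative : ∀ {q} → q ℚ.< 0ℚ →
    ∃[ a ] ∃[ b ] a ℚ.< 0ℚ × b ℚ.< 0ℚ × q ℚ.< a ℚ.+ b
  split-negative {q} q<0 =
    let a , q<a , a<0 = ℚ.<-dense q<0
        d<0 = subst (q ℚ.- a ℚ.<_) (ℚ.+-inverseʳ a) (ℚ.+-monoˡ-< (ℚ.- a) q<a)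
        b , d<b , b<0 = ℚ.<-dense d<0
    in a , b , a<0 , b<0 ,
       subst (ℚ._< a ℚ.+ b) (cancel a q) (ℚ.+-monoʳ-< a d<b)

_⊕_ : [0,∞] → [0,∞] → [0,∞]
(x ⊕ y) .cut q = ∃[ a ] ∃[ b ] cut x a × cut y b × q ℚ.< a ℚ.+ b
(x ⊕ y) .down-closed p≤q (a , b , xa , yb , q<a+b) =
  a , b , xa , yb , ℚ.≤-<-trans p≤q q<a+b
(x ⊕ y) .open-above (a , b , xa , yb , p<a+b) =
  let r , p<r , r<a+b = ℚ.<-dense p<a+b in r , p<r , a , b , xa , yb , r<a+b
(x ⊕ y) .nonnegative q<0 =
  let a , b , a<0 , b<0 , q<a+b = split-negative q<0
  in a , b , nonnegative x a<0 , nonnegative y b<0 , q<a+b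

_⊗_ : [0,∞] → [0,∞] → [0,∞]
(x ⊗ y) .cut q =
  q ℚ.< 0ℚ ⊎
  (∃[ a ] ∃[ b ] 0ℚ ℚ.≤ a × 0ℚ ℚ.≤ b × cut x a × cut y b × q ℚ.< a ℚ.* b)
(x ⊗ y) .down-closed p≤q (inj₁ q<0) = inj₁ (ℚ.≤-<-trans p≤q q<0)
(x ⊗ y) .down-closed p≤q (inj₂ (a , b , 0≤a , 0≤b , xa , yb , q<ab)) =
  inj₂ (a , b , 0≤a , 0≤b , xa , yb , ℚ.≤-<-trans p≤q q<ab)
(x ⊗ y) .open-above (inj₁ p<0) =
  let r , p<r , r<0 = ℚ.<-dense p<0 in r , p<r , inj₁ r<0
(x ⊗ y) .open-above (inj₂ (a , b , 0≤a , 0≤b , xa , yb , p<ab)) =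
  let r , p<r , r<ab = ℚ.<-dense p<ab
  in r , p<r , inj₂ (a , b , 0≤a , 0≤b , xa , yb , r<ab)
(x ⊗ y) .nonnegative = inj₁

module _ {A : Set} where

  listSum : (A → [0,∞]) → List A → [0,∞]
  listSum f []       = 𝟘
  listSum f (x ∷ xs) = f x ⊕ listSum f xs

  -- ∑ P f is the sum of f over { x ∣ P x }: the supremum of the sums of f over
  -- the finite subsets, given as duplicate-free lists.  Proofs of P x are not
  -- part of the index, so no element is counted twice.
  ∑ : Pred A 0ℓ → (A → [0,∞]) → [0,∞]
  ∑ P f .cut q = ∃[ xs ] Unique xs × All P xs × cut (listSum f xs) q
  ∑ P f .down-closed p≤q (xs , u , ps , h) =
    xs , u , ps , down-closed (listSum f xs) p≤q h
  ∑ P f .open-above (xs , u , ps , h) =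
    let r , p<r , h′ = open-above (listSum f xs) h in r , p<r , xs , u , ps , h′
  ∑ P f .nonnegative q<0 = [] , [] , [] , inj₁ q<0

------------------------------------------------------------------------
-- Distributions

-- Having total mass 1 forces every single mass to lie in [0,1].  When equality
-- on A is decidable it also makes every mass a two-sided (located) real, since
-- mass x and the mass of the complement of x add up to 1.
record Distr (A : Set) : Set₁ where
  field
    mass  : A → [0,∞]
    total : ∑ U mass ≈ 𝟙

open Distr public

infix 4 _≋_

_≋_ : {A : Set} → (A → [0,∞]) → (A → [0,∞]) → Set
f ≋ g = ∀ x → f x ≈ g x

module _ {A : Set} (x : A) where

  private
    point : A → [0,∞]
    point y = [ x ≡ y ]

    avoiding : ∀ {q} xs → All (λ y → x ≡ y → ⊥) xs →
               cut (listSum point xs) q → q ℚ.< 0ℚ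
    avoiding []       []       (inj₁ q<0) = q<0
    avoiding (y ∷ ys) (n ∷ ns) (a , b , inj₁ a<0 , h , q<a+b) =
      ℚ.<-trans q<a+b (ℚ.+-mono-< a<0 (avoiding ys ns h))
    avoiding (y ∷ ys) (n ∷ ns) (a , b , inj₂ (e , _) , h , q<a+b) =
      contradiction e n

    bounded : ∀ {q} xs → Unique xs → cut (listSum point xs) q → q ℚ.< 1ℚ
    bounded []       []      (inj₁ q<0) = ℚ.<-trans q<0 (ℚ.positive⁻¹ 1ℚ)
    bounded (y ∷ ys) (_ ∷ u) (a , b , inj₁ a<0 , h , q<a+b) =
      ℚ.<-trans q<a+b (ℚ.+-mono-< a<0 (bounded ys u h))
    bounded (y ∷ ys) (n ∷ _) (a , b , inj₂ (refl , a<1) , h , q<a+b) =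
      ℚ.<-trans q<a+b (ℚ.+-mono-< a<1 (avoiding ys n h))

    attained : ∀ {q} → q ℚ.< 1ℚ → cut (∑ U point) q
    attained {q} q<1 =
      let a , q<a , a<1 = ℚ.<-dense q<1
          d<0 = subst (q ℚ.- a ℚ.<_) (ℚ.+-inverseʳ a)
                  (ℚ.+-monoˡ-< (ℚ.- a) q<a)
          b , d<b , b<0 = ℚ.<-dense d<0
      in x ∷ [] , [] ∷ [] , tt ∷ [] ,
         a , b , inj₂ (refl , a<1) , inj₁ b<0 ,
         subst (ℚ._< a ℚ.+ b) (cancel a q) (ℚ.+-monoʳ-< a d<b)

  dirac : Distr A
  dirac .mass  = point
  dirac .total =
    (λ (xs , u , _ , h) → inj₂ (tt , bounded xs u h)) ,
    λ { (inj₁ q<0)       → nonnegative (∑ U point) q<0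
      ; (inj₂ (_ , q<1)) → attained q<1 }

-- Equivalence of distributions; R s is the R-class of s.
SameOnClasses : {S : Set} → Rel S 0ℓ → Distr S → Distr S → Set
SameOnClasses R μ μ′ = ∀ s → ∑ (R s) (mass μ) ≈ ∑ (R s) (mass μ′)

------------------------------------------------------------------------
-- Probabilistic automata

-- The countable relation Δ ⊆ State × Act × Distr State is represented by a
-- countable index set Trans together with an injective enumeration
-- t ↦ (source t , label t , target t) of its elements; equality of
-- distributions is pointwise equality of their masses.
record PA : Set₁ where
  field
    State           : Set
    initial         : State
    Act             : Set
    τ               : Act
    Trans           : Set
    source          : Trans → State
    label           : Trans → Act
    target          : Trans → Distr State
    state-countable : State ↣ ℕ
    act-countable   : Act ↣ ℕ
    trans-countable : Trans ↣ ℕ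
    trans-injective : ∀ {t u} → source t ≡ source u → label t ≡ label u →
                      mass (target t) ≋ mass (target u) → t ≡ u

module Automaton (𝒜 : PA) where
  open PA 𝒜 public

  -- t is the element (s , a , μ) of Δ.
  IsTransition : Trans → State → Act → Distr State → Set
  IsTransition t s a μ =
    source t ≡ s × label t ≡ a × mass (target t) ≋ mass μ

  _—[_]→_ : State → Act → Distr State → Set
  s —[ a ]→ μ = ∃[ t ] IsTransition t s a μ

  ----------------------------------------------------------------------
  -- Paths and schedulers

  -- Finite paths from s.  The side conditions are irrelevant so that paths with
  -- the same transitions and states are equal, as needed when summing over them.
  data Path (s : State) : Set
  last : ∀ {s} → Path s → State

  data Path s where
    start : Path s
    step  : (π : Path s) (t : Trans) (v : State) →
            .(source t ≡ last π) → .(Positive (mass (target t) v)) → Path s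

  last {s} start    = s
  last (step _ _ v _ _) = v

  -- nothing stands for ⊥ (stopping).
  record Scheduler : Set₁ where
    field
      choice  : ∀ {s} → Path s → Distr (Maybe Trans)
      enabled : ∀ {s} (π : Path s) (t : Trans) →
                Positive (mass (choice π) (just t)) → source t ≡ last π

  open Scheduler public

  prob : Scheduler → ∀ {s} → Path s → [0,∞]
  prob 𝒮 start = 𝟙
  prob 𝒮 (step π t v _ _) =
    prob 𝒮 π ⊗ mass (choice 𝒮 π) (just t) ⊗ mass (target t) v

  Scheduled : Scheduler → ∀ {s} → Pred (Path s) 0ℓ
  Scheduled 𝒮 start            = ⊤
  Scheduled 𝒮 (step π t _ _ _) =
    Scheduled 𝒮 π × Positive (mass (choice 𝒮 π) (just t))

  Maximal : Scheduler → ∀ {s} → Pred (Path s) 0ℓ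
  Maximal 𝒮 π = Scheduled 𝒮 π × Positive (mass (choice 𝒮 π) nothing)

  final : Scheduler → State → State → [0,∞]
  final 𝒮 s s′ = ∑ {A = Path s} (λ π → Maximal 𝒮 π × last π ≡ s′)
                   (λ π → prob 𝒮 π ⊗ mass (choice 𝒮 π) nothing)

  ----------------------------------------------------------------------
  -- Branching bisimulation

  module _ (R : Rel State 0ℓ) where

    Silent : ∀ {s} → Pred (Path s) 0ℓ
    Silent start                = ⊤
    Silent {s} (step π t v _ _) = Silent π × label t ≡ τ × R s v

    -- The last action is a; all earlier steps are silent and stay R-related
    -- to the first state.
    BranchingPath : Act → ∀ {s} → Pred (Path s) 0ℓ
    BranchingPath a start            = ⊥
    BranchingPath a (step π t _ _ _) = Silent π × label t ≡ a

    BranchingStep : State → Act → Distr State → Set₁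
    BranchingStep s a μ =
      (a ≡ τ × mass μ ≋ mass (dirac s)) ⊎
      (Σ Scheduler λ 𝒮 → final 𝒮 s ≋ mass μ ×
         (∀ (π : Path s) → Maximal 𝒮 π → BranchingPath a π))

  record IsBranchingBisimulation (R : Rel State 0ℓ) : Set₁ where
    field
      isEquivalence : IsEquivalence R
      simulate      : ∀ {s t a μ} → R s t → s —[ a ]→ μ →
                      ∃[ μ′ ] BranchingStep R t a μ′ × SameOnClasses R μ μ′

  BranchingBisimilar : State → State → Set₁
  BranchingBisimilar p q = ∃[ R ] IsBranchingBisimulation R × R p q

  ----------------------------------------------------------------------
  -- Confluence

  DeterministicTau : Pred Trans 0ℓ
  DeterministicTau t =
    label t ≡ τ × ∃[ v ] mass (target t) ≋ mass (dirac v)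

  module Confluence (c : Pred Trans 0ℓ) where

    _→c_ : Rel State 0ℓ
    s →c s′ = ∃[ t ] c t × IsTransition t s τ (dirac s′)

    _↠c_ : Rel State 0ℓ
    _↠c_ = Star _→c_

    _↔c*_ : Rel State 0ℓ
    _↔c*_ = EqClosure _→c_

    Rc : Rel State 0ℓ
    Rc s s′ = ∃[ u ] s ↠c u × s′ ↠c u

    record WeaklyConfluent : Set₁ where
      field
        isEquivalence : IsEquivalence Rc
        confluent     : ∀ {s t a μ} → s ↠c t → s —[ a ]→ μ →
          ∃[ t′ ] t ↠c t′ ×
            ((∃[ ν ] t′ —[ a ]→ ν × SameOnClasses Rc μ ν) ⊎
             (a ≡ τ × SameOnClasses Rc μ (dirac t′)))

{-# OPTIONS --safe #-}
-- Rc itself is a branching bisimulation.  Let s ↠c u and t ↠c u, and let s —[a]→ μ.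
-- Confluence gives u ↠c u′ where either u′ —[a]→ ν with ν equivalent to μ, or
-- a ≡ τ and μ is equivalent to 𝟙_u′.  In the first case t walks t ↠c u ↠c u′
-- silently, staying in its Rc-class, and then takes the transition to ν; in the
-- second case t does nothing, since 𝟙_t and 𝟙_u′ are equivalent.
module Submission where

open import Defs
open import Data.Rational.Base as ℚ using (0ℚ; 1ℚ)
import Data.Rational.Properties as ℚ
open import Algebra.Properties.Group ℚ.+-0-group using (//-rightDividesˡ)
open import Data.Empty using (⊥)
open import Data.List.Base using (List; []; _∷_; _++_; drop)
open import Data.List.Relation.Unary.All as All using (All; []; _∷_)
open import Data.List.Relation.Unary.AllPairs using ([]; _∷_)
open import Data.List.Relation.Unary.Any using (Any; here; there)
open import Data.Maybe.Base using (Maybe; just; nothing)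
open import Data.Maybe.Properties using (just-injective)
import Data.Nat.Properties as ℕ
open import Data.Product.Base using (∃-syntax; _×_; _,_; proj₁; proj₂)
open import Data.Sum.Base using (_⊎_; inj₁; inj₂)
open import Data.Unit.Base using (tt)
open import Function.Base using (_∘_)
open import Level using (0ℓ)
open import Relation.Binary.Construct.Closure.Equivalence as EqClosure using ()
open import Relation.Binary.Construct.Closure.ReflexiveTransitive
  using (ε; _◅_; _◅◅_)
open import Relation.Binary.Core using (Rel)
open import Relation.Binary.Definitions using (DecidableEquality)
open import Relation.Binary.PropositionalEquality
  using (_≡_; refl; sym; trans; cong; subst)
open import Relation.Binary.Structures using (IsEquivalence)
open import Relation.Nullary.Decidable using (yes; no; recompute; via-injection)
open import Relation.Nullary.Negation using (contradiction)
open import Relation.Unary using (Pred; _⊆_)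

-- Arithmetic of lower cuts up to `≈`.

≈-refl : ∀ {x} → x ≈ x
≈-refl = (λ h → h) , (λ h → h)

≈-sym : ∀ {x y} → x ≈ y → y ≈ x
≈-sym (f , g) = g , f

≈-trans : ∀ {x y z} → x ≈ y → y ≈ z → x ≈ z
≈-trans (f , g) (h , k) = (λ p → h (f p)) , (λ p → g (k p))

indicator : ∀ {P} → P → [ P ] ≈ 𝟙
indicator p = (λ { (inj₁ q<0) → inj₁ q<0 ; (inj₂ (_ , q<1)) → inj₂ (tt , q<1) }) ,
              (λ { (inj₁ q<0) → inj₁ q<0 ; (inj₂ (_ , q<1)) → inj₂ (p , q<1) })

indicator-positive : ∀ {P} → Positive [ P ] → P
indicator-positive (inj₁ 0<0)     = contradiction refl (ℚ.<⇒≢ 0<0)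
indicator-positive (inj₂ (p , _)) = p

⊗-mono : ∀ {x x′ y y′} → cut x ⊆ cut x′ → cut y ⊆ cut y′ →
         cut (x ⊗ y) ⊆ cut (x′ ⊗ y′)
⊗-mono f g (inj₁ q<0) = inj₁ q<0
⊗-mono f g (inj₂ (a , b , 0≤a , 0≤b , xa , yb , q<ab)) =
  inj₂ (a , b , 0≤a , 0≤b , f xa , g yb , q<ab)

⊗-cong : ∀ {x x′ y y′} → x ≈ x′ → y ≈ y′ → x ⊗ y ≈ x′ ⊗ y′
⊗-cong {x} {x′} {y} {y′} (f , f′) (g , g′) =
  ⊗-mono {x} {x′} {y} {y′} f g , ⊗-mono {x′} {x} {y′} {y} f′ g′

⊗-swap : ∀ x y → cut (x ⊗ y) ⊆ cut (y ⊗ x)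
⊗-swap x y (inj₁ q<0) = inj₁ q<0
⊗-swap x y (inj₂ (a , b , 0≤a , 0≤b , xa , yb , q<ab)) =
  inj₂ (b , a , 0≤b , 0≤a , yb , xa , subst (_ ℚ.<_) (ℚ.*-comm a b) q<ab)

⊗-comm : ∀ x y → x ⊗ y ≈ y ⊗ x
⊗-comm x y = ⊗-swap x y , ⊗-swap y x

⊗-identityˡ : ∀ x → 𝟙 ⊗ x ≈ x
⊗-identityˡ x = to , from
  where
  to : cut (𝟙 ⊗ x) ⊆ cut x
  to (inj₁ q<0) = nonnegative x q<0
  to (inj₂ (a , b , 0≤a , _ , inj₁ a<0 , _)) =
    contradiction (ℚ.≤-<-trans 0≤a a<0) (ℚ.<-irrefl refl)
  to (inj₂ (a , b , _ , 0≤b , inj₂ (_ , a<1) , xb , q<ab)) =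
    down-closed x (ℚ.≤-trans (ℚ.<⇒≤ q<ab) ab≤b) xb
    where
    instance _ = ℚ.nonNegative 0≤b
    ab≤b : a ℚ.* b ℚ.≤ b
    ab≤b = subst (a ℚ.* b ℚ.≤_) (ℚ.*-identityˡ b)
             (ℚ.*-monoʳ-≤-nonNeg b (ℚ.<⇒≤ a<1))

  from : cut x ⊆ cut (𝟙 ⊗ x)
  from {q} xq with q ℚ.<? 0ℚ
  ... | yes q<0 = inj₁ q<0
  ... | no  q≮0 =
    let b , q<b , xb = open-above x xq in factor b q<b xb
    where
    0≤q = ℚ.≮⇒≥ q≮0
    factor : ∀ b → q ℚ.< b → cut x b → cut (𝟙 ⊗ x) q
    factor b q<b xb =
      -- Here `r` is `q / b`, which is below 1 because `q < b`. Any `a` strictly between `r` and 1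
      -- then gives `q = r * b < a * b`.
      inj₂ (a , b , ℚ.≤-trans 0≤r (ℚ.<⇒≤ r<a) , ℚ.<⇒≤ 0<b , inj₂ (tt , a<1) , xb ,
            subst (ℚ._< a ℚ.* b) rb≡q (ℚ.*-monoˡ-<-pos b r<a))
      where
      0<b = ℚ.≤-<-trans 0≤q q<b
      instance
        b-pos    = ℚ.positive 0<b
        b≢0      = ℚ.pos⇒nonZero b
        1/b-pos  = ℚ.1/pos⇒pos b
        1/b-nneg = ℚ.pos⇒nonNeg (ℚ.1/ b)
      r = q ℚ.* ℚ.1/ b
      r<1 : r ℚ.< 1ℚ
      r<1 = subst (r ℚ.<_) (ℚ.*-inverseʳ b) (ℚ.*-monoˡ-<-pos (ℚ.1/ b) q<b)
      0≤r : 0ℚ ℚ.≤ r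
      0≤r = subst (ℚ._≤ r) (ℚ.*-zeroˡ (ℚ.1/ b)) (ℚ.*-monoʳ-≤-nonNeg (ℚ.1/ b) 0≤q)
      rb≡q : r ℚ.* b ≡ q
      rb≡q = trans (ℚ.*-assoc q (ℚ.1/ b) b)
               (trans (cong (q ℚ.*_) (ℚ.*-inverseˡ b)) (ℚ.*-identityʳ q))
      a   = proj₁ (ℚ.<-dense r<1)
      r<a = proj₁ (proj₂ (ℚ.<-dense r<1))
      a<1 = proj₂ (proj₂ (ℚ.<-dense r<1))

⊗-unitˡ : ∀ {x} y → x ≈ 𝟙 → x ⊗ y ≈ y
⊗-unitˡ {x} y x≈1 =
  ≈-trans {x ⊗ y} {𝟙 ⊗ y} {y} (⊗-cong {x} {𝟙} {y} {y} x≈1 (≈-refl {y})) (⊗-identityˡ y)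

⊗-unitʳ : ∀ x {y} → y ≈ 𝟙 → x ⊗ y ≈ x
⊗-unitʳ x {y} y≈1 =
  ≈-trans {x ⊗ y} {y ⊗ x} {x} (⊗-comm x y) (⊗-unitˡ {y} x y≈1)

⊕-𝟘 : ∀ x → x ⊕ 𝟘 ≈ x
⊕-𝟘 x = to , from
  where
  to : cut (x ⊕ 𝟘) ⊆ cut x
  to (a , b , xa , inj₁ b<0 , q<a+b) =
    down-closed x (ℚ.<⇒≤ (ℚ.<-trans q<a+b
      (subst (a ℚ.+ b ℚ.<_) (ℚ.+-identityʳ a) (ℚ.+-monoʳ-< a b<0)))) xa

  from : cut x ⊆ cut (x ⊕ 𝟘)
  from {q} xq =
    -- The cut of `𝟘` holds only negative rationals. Openness of `x` leaves a gap between `q` and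
    -- `a`, so a small enough negative `b` keeps `q < a + b`.
    let a , q<a , xa = open-above x xq
        d<0 = subst (q ℚ.- a ℚ.<_) (ℚ.+-inverseʳ a) (ℚ.+-monoˡ-< (ℚ.- a) q<a)
        b , d<b , b<0 = ℚ.<-dense d<0
    in a , b , xa , inj₁ b<0 , subst (ℚ._< a ℚ.+ b) (cancel a q) (ℚ.+-monoʳ-< a d<b)
    where
    cancel : ∀ a q → a ℚ.+ (q ℚ.- a) ≡ q
    cancel a q = trans (ℚ.+-comm a (q ℚ.- a)) (//-rightDividesˡ a q)

-- Sums over subsets and point masses.

module _ {A : Set} where

  ∑-member : ∀ {P : Pred A 0ℓ} f x → P x → cut (f x) ⊆ cut (∑ P f)
  ∑-member f x Px h = x ∷ [] , [] ∷ [] , Px ∷ [] , proj₂ (⊕-𝟘 (f x)) h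

  -- A duplicate-free list drawn from a subsingleton has at most one entry, so each finite sum is
  -- empty or a single term.
  ∑-subsingleton : ∀ {P : Pred A 0ℓ} f y → (∀ {x x′} → P x → P x′ → x ≡ x′) →
                   (∀ {x} → P x → cut (f x) ⊆ cut y) → cut (∑ P f) ⊆ cut y
  ∑-subsingleton f y _ _ ([] , _ , _ , inj₁ q<0) = nonnegative y q<0
  ∑-subsingleton f y _ f⊆y (x ∷ [] , _ , Px ∷ [] , h) = f⊆y Px (proj₁ (⊕-𝟘 (f x)) h)
  ∑-subsingleton f y unique _ (x ∷ x′ ∷ _ , (x≢x′ ∷ _) ∷ _ , Px ∷ Px′ ∷ _ , _) =
    contradiction (unique Px Px′) x≢x′

  -- If the head contributes a negative rational, the tail must contribute a positive one.
  listSum-positive : ∀ f (xs : List A) → Positive (listSum f xs) → Any (Positive ∘ f) xs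
  listSum-positive f []       (inj₁ 0<0) = contradiction refl (ℚ.<⇒≢ 0<0)
  listSum-positive f (x ∷ xs) (a , b , xa , yb , 0<a+b) with a ℚ.<? 0ℚ
  ... | no  a≮0 = here (down-closed (f x) (ℚ.≮⇒≥ a≮0) xa)
  ... | yes a<0 = there (listSum-positive f xs
                    (down-closed (listSum f xs) (ℚ.<⇒≤ (ℚ.<-trans 0<a+b a+b<b)) yb))
    where
    a+b<b : a ℚ.+ b ℚ.< b
    a+b<b = subst (a ℚ.+ b ℚ.<_) (ℚ.+-identityˡ b) (ℚ.+-monoˡ-< b a<0)

  ∑-dirac : ∀ (P : Pred A 0ℓ) x → ∑ P (mass (dirac x)) ≈ [ P x ]
  ∑-dirac P x = to , from
    where
    supported : ∀ {xs} → All P xs → Any (Positive ∘ mass (dirac x)) xs → P x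
    supported (Py ∷ _)  (here p)  = subst P (sym (indicator-positive p)) Py
    supported (_ ∷ Pys) (there p) = supported Pys p

    to : cut (∑ P (mass (dirac x))) ⊆ cut [ P x ]
    to {q} (xs , u , Pxs , h)
      -- The total mass bounds `q` by 1. If `q` is not negative, the finite sum is positive, so some
      -- listed element has positive mass; it equals `x`, and being listed it satisfies `P`. Thus
      -- only the sign of `q` is decided, never `P x`.
      with q ℚ.<? 0ℚ | proj₁ (total (dirac x)) (xs , u , All.map (λ _ → tt) Pxs , h)
    ... | yes q<0 | _               = inj₁ q<0
    ... | no  _   | inj₁ q<0        = inj₁ q<0
    ... | no  q≮0 | inj₂ (_ , q<1)  =
      inj₂ (supported Pxs (listSum-positive _ xs
              (down-closed (listSum _ xs) (ℚ.≮⇒≥ q≮0) h)) , q<1)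

    from : cut [ P x ] ⊆ cut (∑ P (mass (dirac x)))
    from (inj₁ q<0)        = nonnegative (∑ P (mass (dirac x))) q<0
    from (inj₂ (Px , q<1)) = ∑-member (mass (dirac x)) x Px (inj₂ (refl , q<1))

  dirac-sameOnClasses : ∀ {R : Rel A 0ℓ} → IsEquivalence R → ∀ {x y} → R x y →
                        SameOnClasses R (dirac x) (dirac y)
  dirac-sameOnClasses {R} eq {x} {y} Rxy s =
    ≈-trans {∑ (R s) (mass (dirac x))} {[ R s x ]} {∑ (R s) (mass (dirac y))}
      (∑-dirac (R s) x)
      (≈-trans {[ R s x ]} {[ R s y ]} {∑ (R s) (mass (dirac y))}
        ( indicator-mono (λ Rsx → IsEquivalence.trans eq Rsx Rxy)
        , indicator-mono (λ Rsy → IsEquivalence.trans eq Rsy (IsEquivalence.sym eq Rxy)))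
        (≈-sym {∑ (R s) (mass (dirac y))} {[ R s y ]} (∑-dirac (R s) y)))
    where
    indicator-mono : ∀ {P Q : Set} → (P → Q) → cut [ P ] ⊆ cut [ Q ]
    indicator-mono f (inj₁ q<0)       = inj₁ q<0
    indicator-mono f (inj₂ (p , q<1)) = inj₂ (f p , q<1)

-- A scheduler that executes a fixed list of transitions.

module _ (𝒜 : PA) where
  open Automaton 𝒜

  _≟_ : DecidableEquality State
  _≟_ = via-injection state-countable ℕ._≟_

  -- The source is tested because `enabled` must hold for every path, including those that leave the
  -- intended walk; there the scheduler stops.
  follow : State → List Trans → Maybe Trans
  follow s []      = nothing
  follow s (t ∷ _) with source t ≟ s
  ... | yes _ = just t
  ... | no  _ = nothing

  follow-source : ∀ {s t} ts → follow s ts ≡ just t → source t ≡ s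
  follow-source {s} (t ∷ _) eq with source t ≟ s
  follow-source (t ∷ _) refl | yes e = e

  follow-∷ : ∀ {s t} ts → source t ≡ s → follow s (t ∷ ts) ≡ just t
  follow-∷ {s} {t} ts e with source t ≟ s
  ... | yes _  = refl
  ... | no  ¬e = contradiction e ¬e

  module _ (ts : List Trans) where

    -- Transitions are chosen by the number of steps taken rather than by the current
    -- state alone, since a walk along c may revisit states.
    remaining : ∀ {s} → Path s → List Trans
    remaining start            = ts
    remaining (step π _ _ _ _) = drop 1 (remaining π)

    follower : Scheduler
    follower .choice π      = dirac (follow (last π) (remaining π))
    follower .enabled π t p = follow-source (remaining π) (indicator-positive p)

    follower-just : ∀ {s t} {π : Path s} {rest} → remaining π ≡ t ∷ rest →
                    source t ≡ last π → mass (choice follower π) (just t) ≈ 𝟙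
    follower-just {rest = rest} eq e rewrite eq = indicator (follow-∷ rest e)

    -- A point mass is positive at one value only, which here is the head of the remaining list.
    follower-next : ∀ {s t t′} {π : Path s} {rest} → remaining π ≡ t ∷ rest →
                    source t ≡ last π →
                    Positive (mass (choice follower π) (just t′)) → t ≡ t′
    follower-next {rest = rest} eq e p rewrite eq =
      just-injective (trans (sym (follow-∷ rest e)) (indicator-positive p))

    follower-moves : ∀ {s t} {π : Path s} {rest} → remaining π ≡ t ∷ rest →
                     source t ≡ last π →
                     Positive (mass (choice follower π) nothing) → ⊥
    follower-moves {rest = rest} eq e p rewrite eq
      with trans (sym (follow-∷ rest e)) (indicator-positive p)
    ... | ()

    follower-nothing : ∀ {s} {π : Path s} → remaining π ≡ [] →
                       mass (choice follower π) nothing ≈ 𝟙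
    follower-nothing eq rewrite eq = indicator refl

    follower-stops : ∀ {s t} {π : Path s} → remaining π ≡ [] →
                     Positive (mass (choice follower π) (just t)) → ⊥
    follower-stops eq p rewrite eq with indicator-positive p
    ... | ()

  positive : ∀ x → x ≈ 𝟙 → Positive x
  positive _ x≈1 = proj₂ x≈1 (inj₂ (tt , ℚ.positive⁻¹ 1ℚ))

  -- Walks along `c` as paths.

  module _ (c : Pred Trans 0ℓ) where
    open Confluence c

    transitions : ∀ {s u} → s ↠c u → List Trans
    transitions ε             = []
    transitions ((t , _) ◅ r) = t ∷ transitions r

    extend : ∀ {s u} (π : Path s) → last π ↠c u → Path s
    extend π ε = π
    extend π (_◅_ {j = v} (t , _ , e , _ , m) r) =
      extend (step π t v e (proj₂ (m v) (inj₂ (refl , ℚ.positive⁻¹ 1ℚ)))) r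

    last-extend : ∀ {s u} (π : Path s) (r : last π ↠c u) → last (extend π r) ≡ u
    last-extend π ε       = refl
    last-extend π (_ ◅ r) = last-extend (step π _ _ _ _) r

    -- The walk from `s` up to the current state is accumulated. Each visited state `v` is then
    -- reachable from `s`, so `v` itself is the common reduct that puts `s` and `v` in `Rc`.
    extend-silent : ∀ {s u} (π : Path s) (r : last π ↠c u) → s ↠c last π →
                    Silent Rc π → Silent Rc (extend π r)
    extend-silent π ε _ silent = silent
    extend-silent π (x@(_ , _ , _ , l , _) ◅ r) s↠ silent =
      extend-silent (step π _ _ _ _) r s↠v (silent , l , _ , s↠v , ε)
      where s↠v = s↠ ◅◅ x ◅ ε

    -- The scheduler that walks along `r₀` and then takes `f`.

    module _ {s₀ u : State} (r₀ : s₀ ↠c u) (f : Trans) (f-source : source f ≡ u) where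

      private
        ts : List Trans
        ts = transitions r₀ ++ f ∷ []

        𝒮 : Scheduler
        𝒮 = follower ts

        π₀ : Path s₀
        π₀ = extend start r₀

        f-enabled : source f ≡ last π₀
        f-enabled = trans f-source (sym (last-extend start r₀))

      record Certain (π : Path s₀) : Set where
        field
          scheduled : Scheduled 𝒮 π
          prob-one  : prob 𝒮 π ≈ 𝟙

      -- Both new factors of the probability are 1 at each step: the choice is a point mass at the
      -- next transition, whose target is a point mass at the next state.
      extend-certain : ∀ π (r : last π ↠c u) → remaining ts π ≡ transitions r ++ f ∷ [] →
                       Certain π →
                       Certain (extend π r) × remaining ts (extend π r) ≡ f ∷ []
      extend-certain π ε eq certain = certain , eq
      extend-certain π (_◅_ {j = v} (t , _ , e , _ , m) r) eq certain =
        extend-certain (step π t v _ _) r (cong (drop 1) eq) record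
          { scheduled = scheduled , positive x chosen
          ; prob-one  = ≈-trans {prob 𝒮 π ⊗ x ⊗ y} {y} {𝟙}
              (⊗-unitˡ {prob 𝒮 π ⊗ x} y
                (≈-trans {prob 𝒮 π ⊗ x} {x} {𝟙} (⊗-unitˡ {prob 𝒮 π} x prob-one) chosen))
              (≈-trans {y} {mass (dirac v) v} {𝟙} (m v) (indicator refl))
          }
        where
        open Certain certain
        x = mass (choice 𝒮 π) (just t)
        y = mass (target t) v
        chosen : x ≈ 𝟙
        chosen = follower-just ts {π = π} eq e

      π₀-certain : Certain π₀ × remaining ts π₀ ≡ f ∷ []
      π₀-certain = extend-certain start r₀ refl
        record { scheduled = tt ; prob-one = ≈-refl {𝟙} }

      -- The walk is forced, so the outcome `v` of `f` is the only freedom left.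
      data Finished : Path s₀ → Set where
        finished : ∀ v .e .p → Finished (step π₀ f v e p)

      finish : ∀ {π t v} .{e} .{p} → π ≡ π₀ → f ≡ t → Finished (step π t v e p)
      finish {e = e} {p} refl refl = finished _ e p

      -- Prefixes of `π₀`, described by their completion: this keeps the pending walk at hand, and
      -- one scheduled step just removes its first edge.
      Walking : Path s₀ → Set
      Walking π = ∃[ r ] remaining ts π ≡ transitions {u = u} r ++ f ∷ [] × extend π r ≡ π₀

      finished-remaining : ∀ {π} → Finished π → remaining ts π ≡ []
      finished-remaining (finished _ _ _) = cong (drop 1) (proj₂ π₀-certain)

      -- Induction on the path: a pending edge of the walk must be the next step, with the walk
      -- exhausted the next step is `f`, and after `f` nothing is scheduled.
      progress : ∀ π → Scheduled 𝒮 π → Walking π ⊎ Finished π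
      progress start _ = inj₁ (r₀ , refl , refl)
      progress (step π t v e p) (scheduled , chosen) with progress π scheduled
      ... | inj₂ fin = contradiction chosen (follower-stops ts {π = π} (finished-remaining fin))
      ... | inj₁ (ε , eq , π≡π₀) =
        inj₂ (finish π≡π₀ (follower-next ts {π = π} eq f-source chosen))
      progress (step π t v e p) (scheduled , chosen)
          | inj₁ (_◅_ {j = v′} (t′ , _ , e′ , _ , m) r , eq , ext)
          with follower-next ts {π = π} eq e′ chosen
      -- The target is a point mass at `v′` and positive at `v`, so the two agree. The proof `p` is
      -- irrelevant, hence the equality is recovered by deciding it.
      ...   | refl with recompute (v′ ≟ v) (indicator-positive (proj₁ (m v) p))
      ...     | refl = inj₁ (r , cong (drop 1) eq , ext)

      maximal-finished : ∀ {π} → Maximal 𝒮 π → Finished π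
      maximal-finished {π} (scheduled , stopped) with progress π scheduled
      ... | inj₂ fin = fin
      ... | inj₁ (ε , eq , _) =
        contradiction stopped (follower-moves ts {π = π} eq f-source)
      ... | inj₁ ((_ , _ , e , _) ◅ _ , eq , _) =
        contradiction stopped (follower-moves ts {π = π} eq e)

      finished-maximal : ∀ {π} → Finished π → Maximal 𝒮 π
      finished-maximal {π} fin@(finished v e p) =
        (Certain.scheduled (proj₁ π₀-certain) ,
          positive (mass (choice 𝒮 π₀) (just f))
            (follower-just ts {π = π₀} (proj₂ π₀-certain) f-enabled)) ,
        positive (mass (choice 𝒮 π) nothing)
          (follower-nothing ts {π = π} (finished-remaining fin))

      weight : Path s₀ → [0,∞]
      weight π = prob 𝒮 π ⊗ mass (choice 𝒮 π) nothing

      -- The walk, the choice of `f` and the final stop all have probability 1, so only the mass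
      -- that `f` gives to its outcome survives.
      finished-weight : ∀ {π} → Finished π → weight π ≈ mass (target f) (last π)
      finished-weight {π} fin@(finished v e p) =
        ≈-trans {weight π} {prob 𝒮 π} {y}
          (⊗-unitʳ (prob 𝒮 π) {mass (choice 𝒮 π) nothing}
            (follower-nothing ts {π = π} (finished-remaining fin)))
          (⊗-unitˡ {prob 𝒮 π₀ ⊗ x} y
            (≈-trans {prob 𝒮 π₀ ⊗ x} {x} {𝟙}
              (⊗-unitˡ {prob 𝒮 π₀} x (Certain.prob-one (proj₁ π₀-certain)))
              (follower-just ts {π = π₀} (proj₂ π₀-certain) f-enabled)))
        where
        x = mass (choice 𝒮 π₀) (just f)
        y = mass (target f) v

      -- At most one maximal path ends in `v`, since a finished path is determined by its last
      -- state. The sum therefore has at most one term.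
      walk-final : final 𝒮 s₀ ≋ mass (target f)
      walk-final v = ∑-subsingleton weight (mass (target f) v) unique bound , from
        where
        unique : ∀ {π π′} → Maximal 𝒮 π × last π ≡ v → Maximal 𝒮 π′ × last π′ ≡ v → π ≡ π′
        unique (max , refl) (max′ , l) with maximal-finished max | maximal-finished max′
        unique (max , refl) (max′ , refl) | finished _ _ _ | finished _ _ _ = refl

        bound : ∀ {π} → Maximal 𝒮 π × last π ≡ v → cut (weight π) ⊆ cut (mass (target f) v)
        bound (max , refl) = proj₁ (finished-weight (maximal-finished max))

        from : cut (mass (target f) v) ⊆ cut (final 𝒮 s₀ v)
        -- The path with outcome `v` exists only if `v` has positive mass. A non-negative `q` in the
        -- cut supplies this; a negative `q` lies in every cut.
        from {q} h with q ℚ.<? 0ℚ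
        ... | yes q<0 = nonnegative (final 𝒮 s₀ v) q<0
        ... | no  q≮0 =
          ∑-member {P = λ π → Maximal 𝒮 π × last π ≡ v} weight π
            (finished-maximal {π} fin , refl) (proj₂ (finished-weight {π} fin) h)
          where
          0<v : Positive (mass (target f) v)
          0<v = down-closed (mass (target f) v) (ℚ.≮⇒≥ q≮0) h
          π : Path s₀
          π = step π₀ f v f-enabled 0<v
          fin : Finished π
          fin = finished v f-enabled 0<v

      walk-branching : ∀ π → Maximal 𝒮 π → BranchingPath Rc (label f) π
      walk-branching π max with maximal-finished max
      ... | finished _ _ _ = extend-silent start r₀ ε tt , refl

    -- From walks along `c` to the bisimulation `Rc`.

    ↠c-branchingStep : ∀ {s u a μ} → s ↠c u → u —[ a ]→ μ → BranchingStep Rc s a μ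
    ↠c-branchingStep {s} {μ = μ} r (f , e , refl , m) = inj₂
      -- Even for an empty `r` the list ends with `f`, so every maximal path has at least one step.
      ( follower (transitions r ++ f ∷ [])
      , (λ v → ≈-trans {final _ s v} {mass (target f) v} {mass μ v} (walk-final r f e v) (m v))
      , walk-branching r f e)

    Rc-isBranchingBisimulation : WeaklyConfluent → IsBranchingBisimulation Rc
    Rc-isBranchingBisimulation wc = record
      { isEquivalence = isEquivalence
      ; simulate      = λ {_} {_} {_} {μ} → simulate {μ = μ}
      }
      where
      open WeaklyConfluent wc

      simulate : ∀ {s t a μ} → Rc s t → s —[ a ]→ μ →
                 ∃[ μ′ ] BranchingStep Rc t a μ′ × SameOnClasses Rc μ μ′
      simulate {t = t} {μ = μ} (u , s↠u , t↠u) s→μ with confluent {μ = μ} s↠u s→μ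
      ... | u′ , u↠u′ , inj₁ (ν , u′→ν , μ≡ν) =
        ν , ↠c-branchingStep {μ = ν} (t↠u ◅◅ u↠u′) u′→ν , μ≡ν
      ... | u′ , u↠u′ , inj₂ (a≡τ , μ≡u′) =
        dirac t , inj₁ (a≡τ , λ v → ≈-refl {mass (dirac t) v}) , λ s →
          ≈-trans {∑ (Rc s) (mass μ)} {∑ (Rc s) (mass (dirac u′))} {∑ (Rc s) (mass (dirac t))}
            -- `u′` is its own reduct and is reached from `t` through `u`, so it relates `u′` to
            -- `t`.
            (μ≡u′ s) (dirac-sameOnClasses isEquivalence (u′ , ε , t↠u ◅◅ u↠u′) s)

theorem19 : (𝒜 : PA) → let open Automaton 𝒜 in
    (s s′ : State) (c : Pred Trans 0ℓ) → c ⊆ DeterministicTau →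
    let open Confluence c in
    WeaklyConfluent → s ↔c* s′ → BranchingBisimilar s s′
theorem19 𝒜 s s′ c _ wc s↔s′ =
  Rc , Rc-isBranchingBisimulation 𝒜 c wc ,
  -- A single `c`-step to `v` lies in `Rc` with common reduct `v`; since `Rc` is an equivalence, it
  -- contains the whole closure.
  EqClosure.fold isEquivalence (λ {_} {v} x → v , x ◅ ε , ε) s↔s′
  where
  open Automaton 𝒜
  open Confluence c
  open WeaklyConfluent wc
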